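{- Let $m$ be a reachable node of a sound deterministic negotiation diagram $\mathcal N$. (i) There is a unique reachable configuration $I(m)$ of $\mathcal N$ that enables $m$, and no other node. (ii) There is a unique configuration $F(m)$ such that $F(m)$ is reachable from $I(m)$ by means of an $m$-sequence, and for every node $n$ enabled at $F(m)$, $\mathrm{dom}(n)$ is not included in $\mathrm{dom}(m)$. (iii) For every location $\ell$ of $m$ (i.e. $\ell=(m,a)$ with $a\in\mathrm{out}(m)$) there is a unique configuration $F(\ell)$ such that $F(\ell)$ is reachable from $I(m)$ by means of a strict $m$-sequence starting with $\ell$, and for every node $n$ enabled at $F(\ell)$, $\mathrm{dom}(n)$ is not strictly included in $\mathrm{dom}(m)$.
   Context: A negotiation diagram $\mathcal N$ is a tuple $(\mathrm{Proc},N,\mathrm{dom},R,\delta)$: $\mathrm{Proc}$ is a finite set of processes, $N$ a finite set of nodes, $\mathrm{dom}(n)\subseteq \mathrm{Proc}$ is a nonempty set for every node $n$, $R$ is a set of outcomes, each node $n$ has a set $\mathrm{out}(n)\subseteq R$ of outcomes, and for every $n\in N$, $a\in \mathrm{out}(n)$, $p\in\mathrm{dom}(n)$ a set $\delta(n,a,p)\subseteq N$ is given such that $p\in\mathrm{dom}(n')$ for all $n'\in\delta(n,a,p)$. There are two distinguished nodes, the initial node $n_{init}$ and the final node $n_{fin}$, with $\mathrm{dom}(n_{init})=\mathrm{dom}(n_{fin})=\mathrm{Proc}$. Every node, except for $n_{fin}$, has at least one outcome. $\mathcal N$ is deterministic if every $\delta(n,a,p)$ is a singleton or empty. A location is a pair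 $\ell=(n,a)$ with $a\in\mathrm{out}(n)$; its domain is $\mathrm{dom}(n)$. A configuration is a map $C:\mathrm{Proc}\to\mathcal P(N)$. A node $n$ is enabled in $C$ if $n\in C(p)$ for all $p\in\mathrm{dom}(n)$. If $n$ is enabled in $C$ and $a\in \mathrm{out}(n)$ then $C\xrightarrow{(n,a)}C'$, where $C'(p)=\delta(n,a,p)$ for $p\in\mathrm{dom}(n)$ and $C'(p)=C(p)$ otherwise. A run from $C$ is a sequence $w$ of locations that can be executed successively from $C$; write $C\xrightarrow{w}C'$ if $w$ is finite and leads from $C$ to $C'$, and say that $C'$ is reachable from $C$ by means of $w$. $C_{init}(p)=\{n_{init}\}$ and $C_{fin}(p)=\{n_{fin}\}$ for all $p$. A run is successful if it starts in $C_{init}$ and ends in $C_{fin}$. $\mathcal N$ is sound if every finite run from $C_{init}$ can be completed to a successful run. A configuration is reachable if it is reachable from $C_{init}$ by a finite run; a node is reachable if it is enabled at some reachable configuration. For a node $m$, an $m$-sequence is a finite sequence of locations whose domains are all included in $\mathrm{dom}(m)$. A strict $m$-sequence is an $m$-sequence in which the domains of all locations, except possibly the first one, are strictly included in $\mathrm{dom}(m)$.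
   Formalization: In (ii) the condition on nodes enabled at F(m) exempts the final node n_fin: if dom(m)=Proc (e.g. m=n_init), soundness makes every reachable configuration enable some node, whose domain lies in dom(m), so (ii) fails literally; if dom(m)≠Proc the exemption changes nothing. -}

module Defs where

open import Level using (Level; suc; _⊔_)
open import Data.Nat.Base using (ℕ)
open import Data.Fin.Base using (Fin)
open import Data.Fin.Subset using (Subset; _∈_; _∉_; _⊆_; _⊂_; _⊈_; _⊄_; ⁅_⁆; ⊤; ⊥; Nonempty)
open import Data.List.Base using (List; []; _∷_; _++_; drop)
open import Data.List.Relation.Unary.All using (All)
open import Data.Product.Base using (∃; _×_)
open import Data.Sum.Base using (_⊎_)
open import Relation.Unary using (Pred)
open import Relation.Binary.PropositionalEquality using (_≡_; _≢_; _≗_)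

-- δ n a p is meaningful only when a ∈ out(n) and p ∈ dom(n).  It is a total
-- function for convenience; its other values are never constrained or used.
record Negotiation (r o : Level) : Set (suc (r ⊔ o)) where
  field
    #proc #node : ℕ

  Proc : Set
  Proc = Fin #proc

  Node : Set
  Node = Fin #node

  field
    dom          : Node → Subset #proc
    dom-nonempty : ∀ n → Nonempty (dom n)
    R            : Set r
    out          : Node → Pred R o
    δ            : Node → R → Proc → Subset #node
    δ-dom        : ∀ {n a p n′} → out n a → p ∈ dom n → n′ ∈ δ n a p → p ∈ dom n′
    ninit nfin   : Node
    dom-ninit    : dom ninit ≡ ⊤
    dom-nfin     : dom nfin ≡ ⊤
    out-nonempty : ∀ n → n ≢ nfin → ∃ (out n)

module _ {r o : Level} (𝒩 : Negotiation r o) where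
  open Negotiation 𝒩

  Deterministic : Set (r ⊔ o)
  Deterministic = ∀ {n a p} → out n a → p ∈ dom n →
                  (∃ λ n′ → δ n a p ≡ ⁅ n′ ⁆) ⊎ δ n a p ≡ ⊥

  record Location : Set (r ⊔ o) where
    constructor loc
    field
      node    : Node
      outcome : R
      valid   : out node outcome

  domˡ : Location → Subset #proc
  domˡ ℓ = dom (Location.node ℓ)

  -- Without function extensionality, equality of configurations is _≗_;
  -- steps and runs below are closed under it.
  Configuration : Set
  Configuration = Proc → Subset #node

  Cinit Cfin : Configuration
  Cinit _ = ⁅ ninit ⁆
  Cfin  _ = ⁅ nfin ⁆

  Enabled : Node → Configuration → Set
  Enabled n C = ∀ {p} → p ∈ dom n → n ∈ C p

  record Step (C : Configuration) (ℓ : Location) (C′ : Configuration) : Set where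
    open Location ℓ
    field
      enabled : Enabled node C
      inside  : ∀ {p} → p ∈ dom node → C′ p ≡ δ node outcome p
      outside : ∀ {p} → p ∉ dom node → C′ p ≡ C p

  data Run : Configuration → List Location → Configuration → Set (r ⊔ o) where
    stop : ∀ {C C′} → C ≗ C′ → Run C [] C′
    _▸_  : ∀ {C C′ C″ ℓ w} → Step C ℓ C′ → Run C′ w C″ → Run C (ℓ ∷ w) C″

  Successful : List Location → Set (r ⊔ o)
  Successful w = Run Cinit w Cfin

  Sound : Set (r ⊔ o)
  Sound = ∀ {w C} → Run Cinit w C → ∃ λ v → Successful (w ++ v)

  Reachable : Configuration → Set (r ⊔ o)
  Reachable C = ∃ λ w → Run Cinit w C

  ReachableNode : Node → Set (r ⊔ o)
  ReachableNode n = ∃ λ C → Reachable C × Enabled n C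

  Sequence : Node → List Location → Set (r ⊔ o)
  Sequence m = All (λ ℓ → domˡ ℓ ⊆ dom m)

  StrictSequence : Node → List Location → Set (r ⊔ o)
  StrictSequence m w = Sequence m w × All (λ ℓ → domˡ ℓ ⊂ dom m) (drop 1 w)

  IsI : Node → Configuration → Set (r ⊔ o)
  IsI m C = Reachable C × Enabled m C × (∀ n → Enabled n C → n ≡ m)

  -- The final node is exempted from the maximality condition: when dom(m) = Proc
  -- (e.g. m = n_init) the intended F(m) is C_fin, which enables n_fin, and
  -- dom(n_fin) = Proc is included in dom(m).  When dom(m) ≠ Proc the exemption
  -- is vacuous.
  IsF : Node → Configuration → Configuration → Set (r ⊔ o)
  IsF m I C = (∃ λ w → Sequence m w × Run I w C) ×
              (∀ n → n ≢ nfin → Enabled n C → dom n ⊈ dom m)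

  IsFˡ : Location → Configuration → Configuration → Set (r ⊔ o)
  IsFˡ ℓ I C = (∃ λ v → StrictSequence m (ℓ ∷ v) × Run I (ℓ ∷ v) C) ×
               (∀ n → Enabled n C → dom n ⊄ dom m)
    where m = Location.node ℓ

{-# OPTIONS --safe #-}

-- A run from a reachable configuration to Cfin, read as a list of locations, is an acyclic
-- memoryless strategy: keep only the last occurrence of each node; then every process moves from
-- a node to n_fin or to a node occurring later in the list.  A completed run from another
-- configuration put in front of such a list gives one strategy for both configurations.
--
-- Existence: playing the strategy, restricted to a set of allowed nodes, ends after one pass
-- through the list in a configuration where no allowed node except n_fin is enabled.
--
-- Uniqueness: let C and D be reachable and suppose that every node other than n_fin enabled at
-- one of them contains a process on which C and D agree.  Play a common strategy from both.
-- By soundness the next node is enabled as soon as one process occupies it, so both plays fire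
-- the same nodes, and C = D.  For I(m) the agreeing processes lie in dom(m), for F(m) outside it.
-- For F(ℓ) one must also treat a node k with dom(k) = dom(m) enabled at one of two candidates.
-- All of dom(m) can then be led to k by a strategy strictly inside dom(m), also from the other
-- candidate, where this strategy is stuck: unless k is enabled there, dom(m) is deadlocked.
module Submission where

open import Defs
open import Level using (Level; _⊔_; 0ℓ)
open import Data.Empty using (⊥-elim)
open import Data.Fin.Properties using (_≟_; any?; all?)
open import Data.Fin.Subset using (Subset; _∈_; _∉_; _⊆_; _⊂_; _⊈_; _⊄_)
open import Data.Fin.Subset.Properties
  using (_∈?_; _⊆?_; _⊂?_; ⊆-antisym; ⊆-⊂-trans; x∈⁅x⁆; x∈⁅y⁆⇒x≡y; ∉⊥; ∈⊤)
open import Data.List.Base using (List; []; _∷_; _++_)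
open import Data.List.Membership.Propositional using () renaming (_∈_ to _∈ₗ_)
open import Data.List.Relation.Unary.All as All using (All; []; _∷_)
open import Data.List.Relation.Unary.All.Properties using (++⁺)
open import Data.List.Relation.Unary.Any as Any using (Any; here; there)
open import Data.List.Relation.Unary.Any.Properties using (++⁺ʳ)
open import Data.Product using (∃; ∃!; _×_; _,_; proj₁; proj₂)
open import Data.Sum.Base using (_⊎_; inj₁; inj₂; map₁)
open import Data.Unit.Polymorphic.Base using (⊤; tt)
open import Function.Base using (_∘_; id)
open import Relation.Binary.PropositionalEquality
  using (_≡_; _≢_; _≗_; refl; sym; trans; subst)
open import Relation.Nullary using (¬_; Dec; yes; no; contradiction)
open import Relation.Nullary.Decidable using (map′; _→-dec_; _×-dec_; ¬?; decidable-stable)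
open import Relation.Unary using (Pred; Decidable)

⊈⇒∃∉ : ∀ {n} {A B : Subset n} → A ⊈ B → ∃ λ x → x ∈ A × x ∉ B
⊈⇒∃∉ {A = A} {B} A⊈B with any? (λ x → (x ∈? A) ×-dec ¬? (x ∈? B))
... | yes x   = x
... | no  all = contradiction
  (λ {x} x∈A → decidable-stable (x ∈? B) (λ x∉B → all (x , x∈A , x∉B))) A⊈B

module SoundDeterministic {r o : Level} (𝒩 : Negotiation r o)
                          (det : Deterministic 𝒩) (sound : Sound 𝒩) where
  open Negotiation 𝒩
  open Location using (node; outcome; valid)

  private
    variable
      C C′ D D′ E E′ : Configuration 𝒩
      ℓ : Location 𝒩
      w v L : List (Location 𝒩)
      k n t : Node
      p : Proc
      S : Subset #proc

  Enabled? : ∀ n C → Dec (Enabled 𝒩 n C)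
  Enabled? n C = map′ (λ f {p} → f p) (λ f p → f {p})
                      (all? (λ p → (p ∈? dom n) →-dec (n ∈? C p)))

  -- Steps and runs

  step-respˡ : C ≗ D → Step 𝒩 C ℓ E → Step 𝒩 D ℓ E
  step-respˡ {ℓ = ℓ} C≗D s = record
    { enabled = λ {p} p∈ → subst (node ℓ ∈_) (C≗D p) (Step.enabled s p∈)
    ; inside  = Step.inside s
    ; outside = λ {p} p∉ → trans (Step.outside s p∉) (C≗D p)
    }

  run-respˡ : C ≗ D → Run 𝒩 C w E → Run 𝒩 D w E
  run-respˡ C≗D (stop C≗E) = stop (λ p → trans (sym (C≗D p)) (C≗E p))
  run-respˡ C≗D (s ▸ ρ)    = step-respˡ C≗D s ▸ ρ

  run-respʳ : D ≗ E → Run 𝒩 C w D → Run 𝒩 C w E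
  run-respʳ D≗E (stop C≗D) = stop (λ p → trans (C≗D p) (D≗E p))
  run-respʳ D≗E (s ▸ ρ)    = s ▸ run-respʳ D≗E ρ

  run-++ : Run 𝒩 C w D → Run 𝒩 D v E → Run 𝒩 C (w ++ v) E
  run-++ (stop C≗D) σ = run-respˡ (λ p → sym (C≗D p)) σ
  run-++ (s ▸ ρ)    σ = s ▸ run-++ ρ σ

  step-functional : Step 𝒩 C ℓ D → Step 𝒩 C ℓ E → D ≗ E
  step-functional {ℓ = ℓ} s s′ p with p ∈? dom (node ℓ)
  ... | yes p∈ = trans (Step.inside s p∈) (sym (Step.inside s′ p∈))
  ... | no  p∉ = trans (Step.outside s p∉) (sym (Step.outside s′ p∉))

  -- Steps are functional, so the first part of a run fixes where the rest starts; this turns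
  -- soundness into a completing run from any reachable configuration.
  run-cancelˡ : Run 𝒩 C w D → Run 𝒩 C (w ++ v) E → Run 𝒩 D v E
  run-cancelˡ (stop C≗D) σ        = run-respˡ C≗D σ
  run-cancelˡ (s ▸ ρ)    (s′ ▸ σ) = run-cancelˡ ρ (run-respˡ (step-functional s′ s) σ)

  fire : ∀ ℓ → Enabled 𝒩 (node ℓ) C → ∃ (Step 𝒩 C ℓ)
  fire {C} ℓ en = C⁺ , record { enabled = en ; inside = inside ; outside = outside }
    where
    C⁺ : Configuration 𝒩
    C⁺ p with p ∈? dom (node ℓ)
    ... | yes _ = δ (node ℓ) (outcome ℓ) p
    ... | no  _ = C p

    inside : p ∈ dom (node ℓ) → C⁺ p ≡ δ (node ℓ) (outcome ℓ) p
    inside {p} p∈ with p ∈? dom (node ℓ)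
    ... | yes _  = refl
    ... | no  p∉ = contradiction p∈ p∉

    outside : p ∉ dom (node ℓ) → C⁺ p ≡ C p
    outside {p} p∉ with p ∈? dom (node ℓ)
    ... | yes p∈ = contradiction p∈ p∉
    ... | no  _  = refl

  Within StrictlyWithin : Subset #proc → List (Location 𝒩) → Set (r ⊔ o)
  Within S         = All (λ ℓ → domˡ 𝒩 ℓ ⊆ S)
  StrictlyWithin S = All (λ ℓ → domˡ 𝒩 ℓ ⊂ S)

  strictly⇒within : StrictlyWithin S w → Within S w
  strictly⇒within []              = []
  strictly⇒within (ℓ⊂S ∷ w⊂S)   = proj₁ ℓ⊂S ∷ strictly⇒within w⊂S

  within-strictly : ∀ {T} → Within S w → S ⊂ T → StrictlyWithin T w
  within-strictly []          S⊂T = []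
  within-strictly (ℓ⊆S ∷ w⊆S) S⊂T = ⊆-⊂-trans ℓ⊆S S⊂T ∷ within-strictly w⊆S S⊂T

  run-outside : Run 𝒩 C w D → Within S w → p ∉ S → D p ≡ C p
  run-outside {p = p} (stop C≗D) []          p∉S = sym (C≗D p)
  run-outside         (s ▸ ρ)    (ℓ⊆S ∷ w⊆S) p∉S =
    trans (run-outside ρ w⊆S p∉S) (Step.outside s (p∉S ∘ ℓ⊆S))

  -- Reachable configurations

  reachable-run : Reachable 𝒩 C → Run 𝒩 C w D → Reachable 𝒩 D
  reachable-run (_ , ρ) σ = _ , run-++ ρ σ

  reachable-step : Reachable 𝒩 C → Step 𝒩 C ℓ D → Reachable 𝒩 D
  reachable-step reach s = reachable-run reach (s ▸ stop (λ _ → refl))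

  completion : Reachable 𝒩 D → ∃ λ v → Run 𝒩 D v (Cfin 𝒩)
  completion (_ , ρ) with sound ρ
  ... | v , σ = v , run-cancelˡ ρ σ

  AtMostOne : Configuration 𝒩 → Set
  AtMostOne C = ∀ {p n n′} → n ∈ C p → n′ ∈ C p → n ≡ n′

  step-atMostOne : Step 𝒩 C ℓ D → AtMostOne C → AtMostOne D
  step-atMostOne {ℓ = ℓ} s amo {p} n∈ n′∈ with p ∈? dom (node ℓ)
  ... | no p∉ = amo (subst (_ ∈_) (Step.outside s p∉) n∈) (subst (_ ∈_) (Step.outside s p∉) n′∈)
  ... | yes p∈ with det (valid ℓ) p∈
  ...   | inj₁ (m , δ≡m) =
    trans (x∈⁅y⁆⇒x≡y m (subst (_ ∈_) Dp≡ n∈)) (sym (x∈⁅y⁆⇒x≡y m (subst (_ ∈_) Dp≡ n′∈)))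
    where Dp≡ = trans (Step.inside s p∈) δ≡m
  ...   | inj₂ δ≡⊥ = ⊥-elim (∉⊥ (subst (_ ∈_) (trans (Step.inside s p∈) δ≡⊥) n∈))

  run-atMostOne : Run 𝒩 C w D → AtMostOne C → AtMostOne D
  run-atMostOne (stop C≗D) amo {p} n∈ n′∈ =
    amo (subst (_ ∈_) (sym (C≗D p)) n∈) (subst (_ ∈_) (sym (C≗D p)) n′∈)
  run-atMostOne (s ▸ ρ) amo = run-atMostOne ρ (step-atMostOne s amo)

  reachable-atMostOne : Reachable 𝒩 D → AtMostOne D
  reachable-atMostOne (_ , ρ) = run-atMostOne ρ
    (λ n∈ n′∈ → trans (x∈⁅y⁆⇒x≡y ninit n∈) (sym (x∈⁅y⁆⇒x≡y ninit n′∈)))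

  reachable-δ-dom : Reachable 𝒩 D → n ∈ D p → p ∈ dom n
  reachable-δ-dom (_ , ρ) = along ρ
    (λ n∈ → subst (λ m → _ ∈ dom m) (sym (x∈⁅y⁆⇒x≡y ninit n∈)) (subst (_ ∈_) (sym dom-ninit) ∈⊤))
    where
    Located : Configuration 𝒩 → Set
    Located C = ∀ {p n} → n ∈ C p → p ∈ dom n

    along : Run 𝒩 C w D → Located C → Located D
    along (stop C≗D) located {p} n∈ = located (subst (_ ∈_) (sym (C≗D p)) n∈)
    along (_▸_ {C} {C′} {ℓ = ℓ} s ρ) located = along ρ located′
      where
      located′ : Located C′
      located′ {p} n∈ with p ∈? dom (node ℓ)
      ... | yes p∈ = δ-dom (valid ℓ) p∈ (subst (_ ∈_) (Step.inside s p∈) n∈)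
      ... | no  p∉ = located (subst (_ ∈_) (Step.outside s p∉) n∈)

  -- A process without a node could take part in no further step and would never arrive at `nfin`;
  -- the induction goes backwards along a completing run.
  reachable-occupied : Reachable 𝒩 D → ∀ p → ∃ λ n → n ∈ D p
  reachable-occupied reach p = occupied (proj₂ (completion reach))
    where
    occupied : Run 𝒩 C w (Cfin 𝒩) → ∃ λ n → n ∈ C p
    occupied (stop C≗fin) = nfin , subst (nfin ∈_) (sym (C≗fin p)) (x∈⁅x⁆ nfin)
    occupied (_▸_ {ℓ = ℓ} s ρ) with p ∈? dom (node ℓ)
    ... | yes p∈ = node ℓ , Step.enabled s p∈
    ... | no  p∉ with occupied ρ
    ...   | n , n∈ = n , subst (n ∈_) (Step.outside s p∉) n∈

  common-node : AtMostOne C → AtMostOne D → n ∈ C p → n ∈ D p → C p ≡ D p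
  common-node {C} {D} amoC amoD n∈C n∈D = ⊆-antisym
    (λ x∈ → subst (_∈ D _) (amoC n∈C x∈) n∈D)
    (λ x∈ → subst (_∈ C _) (amoD n∈D x∈) n∈C)

  stay : AtMostOne C → Run 𝒩 C w D → All (λ ℓ → node ℓ ≢ n) w → n ∈ C p → n ∈ D p
  stay {p = p} amo (stop C≗D) [] n∈ = subst (_ ∈_) (C≗D p) n∈
  stay {p = p} amo (_▸_ {ℓ = ℓ} s ρ) (ℓ≢n ∷ w≢n) n∈ with p ∈? dom (node ℓ)
  ... | yes p∈ = contradiction (amo (Step.enabled s p∈) n∈) ℓ≢n
  ... | no  p∉ =
    stay (step-atMostOne s amo) ρ w≢n (subst (_ ∈_) (sym (Step.outside s p∉)) n∈)

  p∈dom-nfin : p ∈ dom nfin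
  p∈dom-nfin {p} = subst (p ∈_) (sym dom-nfin) ∈⊤

  -- With nothing but `nfin` enabled, a completing run is empty or fires `nfin` first, which
  -- requires every process there.
  no-deadlock : Reachable 𝒩 D → (∀ {k} → Enabled 𝒩 k D → k ≡ nfin) → n ∈ D p → n ≡ nfin
  no-deadlock {p = p} reach only n∈ with completion reach
  ... | _ , stop D≗fin = x∈⁅y⁆⇒x≡y nfin (subst (_ ∈_) (D≗fin p) n∈)
  ... | _ , _▸_ {ℓ = ℓ} s _ with only (Step.enabled s)
  ...   | ℓ≡nfin = trans
    (reachable-atMostOne reach n∈
      (Step.enabled s (subst (λ x → p ∈ dom x) (sym ℓ≡nfin) p∈dom-nfin)))
    ℓ≡nfin

  -- Acyclic strategies

  _occursIn_ : Node → List (Location 𝒩) → Set (r ⊔ o)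
  n occursIn L = Any (λ ℓ → node ℓ ≡ n) L

  _occursIn?_ : ∀ n L → Dec (n occursIn L)
  n occursIn? L = Any.any? (λ ℓ → node ℓ ≟ n) L

  -- The target t is n_fin, or in the analysis of F(ℓ) a node with the domain of m.
  Leads : Node → List (Location 𝒩) → Node → Set (r ⊔ o)
  Leads t L n = n occursIn L ⊎ n ≡ t

  Good : Node → List (Location 𝒩) → Set (r ⊔ o)
  Good t []      = ⊤
  Good t (ℓ ∷ L) =
    (∀ {p n} → p ∈ dom (node ℓ) → n ∈ δ (node ℓ) (outcome ℓ) p → Leads t L n) × Good t L

  Covered : Node → List (Location 𝒩) → Configuration 𝒩 → Set (r ⊔ o)
  Covered t L C = ∀ {p n} → p ∈ dom t → n ∈ C p → Leads t L n

  leads-∷ : Leads t L n → Leads t (ℓ ∷ L) n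
  leads-∷ = map₁ there

  leads-repeated : node ℓ occursIn L → Leads t (ℓ ∷ L) n → Leads t L n
  leads-repeated ℓ∈L (inj₁ (here refl)) = inj₁ ℓ∈L
  leads-repeated ℓ∈L (inj₁ (there n∈L)) = inj₁ n∈L
  leads-repeated ℓ∈L (inj₂ n≡t)         = inj₂ n≡t

  leads-target : node ℓ ≡ t → Leads t (ℓ ∷ L) n → Leads t L n
  leads-target ℓ≡t (inj₁ (here refl)) = inj₂ ℓ≡t
  leads-target ℓ≡t (inj₁ (there n∈L)) = inj₁ n∈L
  leads-target ℓ≡t (inj₂ n≡t)         = inj₂ n≡t

  leads-≢ : node ℓ ≢ n → Leads t (ℓ ∷ L) n → Leads t L n
  leads-≢ ℓ≢n (inj₁ (here ℓ≡n))  = contradiction ℓ≡n ℓ≢n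
  leads-≢ ℓ≢n (inj₁ (there n∈L)) = inj₁ n∈L
  leads-≢ ℓ≢n (inj₂ n≡t)         = inj₂ n≡t

  good-next : Good t L → ℓ ∈ₗ L → p ∈ dom (node ℓ) → n ∈ δ (node ℓ) (outcome ℓ) p → Leads t L n
  good-next (next , good) (here refl) p∈ n∈ = leads-∷ (next p∈ n∈)
  good-next (next , good) (there ℓ∈L) p∈ n∈ = leads-∷ (good-next good ℓ∈L p∈ n∈)

  covered-step : (∀ {p n} → p ∈ dom (node ℓ) → n ∈ δ (node ℓ) (outcome ℓ) p → Leads t L n) →
                 (∀ {p n} → p ∈ dom t → p ∉ dom (node ℓ) → n ∈ C p → Leads t L n) →
                 Step 𝒩 C ℓ D → Covered t L D
  covered-step {ℓ = ℓ} moved unmoved s {p} p∈t n∈ with p ∈? dom (node ℓ)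
  ... | yes p∈ = moved p∈ (subst (_ ∈_) (Step.inside s p∈) n∈)
  ... | no  p∉ = unmoved p∈t p∉ (subst (_ ∈_) (Step.outside s p∉) n∈)

  -- Locations of `L`, fired in any order, only send processes to nodes of `L` or to `t`.
  covered-run : Good t L → Run 𝒩 C w D → All (_∈ₗ L) w → Covered t L C → Covered t L D
  covered-run good (stop C≗D) []          cov {p} p∈ n∈ = cov p∈ (subst (_ ∈_) (sym (C≗D p)) n∈)
  covered-run good (s ▸ ρ)    (ℓ∈L ∷ w⊆L) cov           =
    covered-run good ρ w⊆L (covered-step (good-next good ℓ∈L) (λ p∈t _ → cov p∈t) s)

  -- After each step of the run a process waits for a later location of `v` or, unmoved until `D`,
  -- for `L`. `AtMostOne` identifies the node a fired process was at.
  prolong : AtMostOne C → Run 𝒩 C v D → Within (dom t) v →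
            Good t L → Covered t L D → Good t (v ++ L) × Covered t (v ++ L) C
  prolong amo (stop C≗D) [] good cov = good , λ {p} p∈ n∈ → cov p∈ (subst (_ ∈_) (C≗D p) n∈)
  prolong {C} {t = t} {L = L} amo (_▸_ {ℓ = ℓ} {w = v} s ρ) (ℓ⊆t ∷ v⊆t) good cov
    with prolong (step-atMostOne s amo) ρ v⊆t good cov
  ... | good′ , cov′ = (next , good′) , cov″
    where
    next : p ∈ dom (node ℓ) → n ∈ δ (node ℓ) (outcome ℓ) p → Leads t (v ++ L) n
    next p∈ n∈ = cov′ (ℓ⊆t p∈) (subst (_ ∈_) (sym (Step.inside s p∈)) n∈)

    cov″ : Covered t (ℓ ∷ v ++ L) C
    cov″ {p} p∈t n∈ with p ∈? dom (node ℓ)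
    ... | yes p∈ = inj₁ (here (amo (Step.enabled s p∈) n∈))
    ... | no  p∉ = leads-∷ (cov′ p∈t (subst (_ ∈_) (sym (Step.outside s p∉)) n∈))

  covered-Cfin : Covered nfin L (Cfin 𝒩)
  covered-Cfin _ n∈ = inj₂ (x∈⁅y⁆⇒x≡y nfin n∈)

  strategy-++ : Reachable 𝒩 D → Good nfin L →
                ∃ λ v → Good nfin (v ++ L) × Covered nfin (v ++ L) D
  strategy-++ reach good with completion reach
  ... | v , ρ = v , prolong (reachable-atMostOne reach) ρ
                            (All.universal (λ _ {_} _ → p∈dom-nfin) v) good covered-Cfin

  strategy : Reachable 𝒩 D → ∃ λ L → Good nfin L × Covered nfin L D
  strategy reach with strategy-++ {L = []} reach tt
  ... | v , good , cov = v ++ [] , good , cov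

  covered-enabled : Covered nfin L D → Enabled 𝒩 k D → Leads nfin L k
  covered-enabled {k = k} cov en = cov p∈dom-nfin (en (proj₂ (dom-nonempty k)))

  -- Playing a strategy on a set of allowed nodes

  record Play (t : Node) (Q : Pred Node 0ℓ) (L : List (Location 𝒩)) (D : Configuration 𝒩)
              : Set (r ⊔ o) where
    constructor mkPlay
    field
      {word}   : List (Location 𝒩)
      {end}    : Configuration 𝒩
      run      : Run 𝒩 D word end
      allowed  : All (Q ∘ node) word
      word⊆L   : All (_∈ₗ L) word
      terminal : Enabled 𝒩 k end → Q k → k ≡ t

  play-∷ : ∀ {Q : Pred Node 0ℓ} → Play t Q L D → Play t Q (ℓ ∷ L) D
  play-∷ (mkPlay ρ a w⊆L end) = mkPlay ρ a (All.map there w⊆L) end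

  -- Only the last occurrence of a node in L is ever fired.
  play : ∀ {Q : Pred Node 0ℓ} → Decidable Q → ∀ L → Good t L → ∀ D →
         (∀ {k} → Enabled 𝒩 k D → Q k → Leads t L k) → Play t Q L D
  play Q? [] good D inv = mkPlay (stop (λ _ → refl)) [] [] λ en q → nothing-left (inv en q)
    where
    nothing-left : Leads t [] k → k ≡ t
    nothing-left (inj₂ k≡t) = k≡t
  play {t} {Q} Q? (ℓ ∷ L) (next , good) D inv
    with node ℓ occursIn? L | Q? (node ℓ) | Enabled? (node ℓ) D
  ... | yes ℓ∈L | _ | _ = play-∷ (play Q? L good D (λ en q → leads-repeated ℓ∈L (inv en q)))
  ... | no _ | no ¬q | _ =
    play-∷ (play Q? L good D (λ en q → leads-≢ (λ { refl → ¬q q }) (inv en q)))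
  ... | no _ | yes _ | no ¬en =
    play-∷ (play Q? L good D (λ en q → leads-≢ (λ { refl → ¬en en }) (inv en q)))
  ... | no _ | yes q | yes en with fire ℓ en
  ...   | D′ , s = prepend (play Q? L good D′ inv′)
    where
    prepend : Play t Q L D′ → Play t Q (ℓ ∷ L) D
    prepend (mkPlay ρ a w⊆L end) = mkPlay (s ▸ ρ) (q ∷ a) (here refl ∷ All.map there w⊆L) end

    inv′ : Enabled 𝒩 k D′ → Q k → Leads t L k
    -- If `k` shares a process with the fired node, that process was just sent to `k`; otherwise `k`
    -- was enabled before.
    inv′ {k} en′ qk with any? (λ p → (p ∈? dom (node ℓ)) ×-dec (p ∈? dom k))
    ... | yes (p , p∈ℓ , p∈k) = next p∈ℓ (subst (k ∈_) (Step.inside s p∈ℓ) (en′ p∈k))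
    ... | no disjoint = leads-≢ ℓ≢k (inv enk qk)
      where
      ℓ≢k : node ℓ ≢ k
      ℓ≢k refl = let p , p∈ = dom-nonempty k in disjoint (p , p∈ , p∈)

      enk : Enabled 𝒩 k D
      enk {p} p∈k = subst (k ∈_) (Step.outside s (λ p∈ℓ → disjoint (p , p∈ℓ , p∈k))) (en′ p∈k)

  -- Uniqueness

  -- A process waiting in vain at the head of the strategy would wait forever.
  occupied⇒enabled : Reachable 𝒩 D → Good nfin (ℓ ∷ L) → Covered nfin (ℓ ∷ L) D →
                     ¬ (node ℓ occursIn L) → node ℓ ≢ nfin →
                     node ℓ ∈ D p → Enabled 𝒩 (node ℓ) D
  occupied⇒enabled {D} {ℓ} {L} reach (_ , good) cov ℓ∉L ℓ≢nfin ℓ∈ =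
    decidable-stable (Enabled? (node ℓ) D) λ ¬en →
      -- The tail does not contain `node ℓ`: playing it leaves the process at `node ℓ` while no node
      -- but `nfin` is enabled, against `no-deadlock`.
      let P = play {Q = λ _ → ⊤} (λ _ → yes tt) L good D
                   (λ en _ → leads-≢ (λ { refl → ¬en en }) (covered-enabled cov en))
          open Play P
          avoids : All (λ ℓ′ → node ℓ′ ≢ node ℓ) word
          avoids = All.map (λ ℓ′∈L ℓ′≡ℓ → ℓ∉L (Any.map (λ { refl → ℓ′≡ℓ }) ℓ′∈L)) word⊆L
      in ℓ≢nfin (no-deadlock (reachable-run reach run) (λ en → terminal en tt)
                             (stay (reachable-atMostOne reach) run avoids ℓ∈))

  Linked : Configuration 𝒩 → Configuration 𝒩 → Set
  Linked C D = ∀ {k} → k ≢ nfin → Enabled 𝒩 k C → ∃ λ p → p ∈ dom k × C p ≡ D p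

  -- A node enabled after the step either meets the domain of `ℓ`, where both configurations now
  -- equal the same `δ`, or was enabled before and keeps its link.
  linked-step : Linked C D → Step 𝒩 C ℓ C′ → Step 𝒩 D ℓ D′ → Linked C′ D′
  linked-step {ℓ = ℓ} link s s′ {k} k≢ en
    with any? (λ p → (p ∈? dom (node ℓ)) ×-dec (p ∈? dom k))
  ... | yes (p , p∈ℓ , p∈k) = p , p∈k , trans (Step.inside s p∈ℓ) (sym (Step.inside s′ p∈ℓ))
  ... | no disjoint with link k≢ (λ {p} p∈k →
            subst (k ∈_) (Step.outside s (λ p∈ℓ → disjoint (p , p∈ℓ , p∈k))) (en p∈k))
  ...   | p , p∈k , C≡D =
    p , p∈k , trans (Step.outside s p∉) (trans C≡D (sym (Step.outside s′ p∉)))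
    where p∉ = λ p∈ℓ → disjoint (p , p∈ℓ , p∈k)

  -- Induction along the common strategy: a head that is neither repeated later nor final is fired
  -- in both configurations, or is vacant in both and dropped. Once the list is exhausted, every
  -- process is at `nfin`.
  linked-covered : ∀ L → Good nfin L → Reachable 𝒩 C → Reachable 𝒩 D →
                   Covered nfin L C → Covered nfin L D → Linked C D → Linked D C → C ≗ D
  linked-covered {C} {D} [] good rC rD covC covD _ _ p
    with reachable-occupied rC p | reachable-occupied rD p
  ... | n , n∈ | n′ , n′∈ with covC p∈dom-nfin n∈ | covD p∈dom-nfin n′∈
  ...   | inj₂ refl | inj₂ refl =
    common-node {C} {D} (reachable-atMostOne rC) (reachable-atMostOne rD) n∈ n′∈
  linked-covered {C} {D} (ℓ ∷ L) (next , good) rC rD covC covD lCD lDC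
    with node ℓ occursIn? L | node ℓ ≟ nfin
  ... | yes ℓ∈L | _ = linked-covered L good rC rD
    (λ p∈ n∈ → leads-repeated ℓ∈L (covC p∈ n∈))
    (λ p∈ n∈ → leads-repeated ℓ∈L (covD p∈ n∈)) lCD lDC
  ... | no _ | yes ℓ≡nfin = linked-covered L good rC rD
    (λ p∈ n∈ → leads-target ℓ≡nfin (covC p∈ n∈))
    (λ p∈ n∈ → leads-target ℓ≡nfin (covD p∈ n∈)) lCD lDC
  ... | no ℓ∉L | no ℓ≢nfin = advance (Enabled? (node ℓ) C)
    where
    -- The linking process of the head sits there in `E` as well, and one occupant is enough.
    transfer : Reachable 𝒩 E → Covered nfin (ℓ ∷ L) E → Linked E′ E →
               Enabled 𝒩 (node ℓ) E′ → Enabled 𝒩 (node ℓ) E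
    transfer rE covE link en with link ℓ≢nfin en
    ... | p , p∈ , E′≡E =
      occupied⇒enabled rE (next , good) covE ℓ∉L ℓ≢nfin (subst (node ℓ ∈_) E′≡E (en p∈))

    vacate : Reachable 𝒩 E → Covered nfin (ℓ ∷ L) E → ¬ Enabled 𝒩 (node ℓ) E → Covered nfin L E
    vacate rE covE ¬en p∈ n∈ = leads-≢
      (λ { refl → ¬en (occupied⇒enabled rE (next , good) covE ℓ∉L ℓ≢nfin n∈) }) (covE p∈ n∈)

    covered-fire : Reachable 𝒩 E → Covered nfin (ℓ ∷ L) E → Step 𝒩 E ℓ E′ → Covered nfin L E′
    covered-fire rE covE s = covered-step next
      (λ {p} p∈ p∉ n∈ → leads-≢ (λ { refl → p∉ (reachable-δ-dom rE n∈) }) (covE p∈ n∈)) s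

    advance : Dec (Enabled 𝒩 (node ℓ) C) → C ≗ D
    advance (no ¬en) = linked-covered L good rC rD
      (vacate rC covC ¬en) (vacate rD covD (¬en ∘ transfer rC covC lDC)) lCD lDC
    advance (yes en) with fire ℓ en | fire ℓ (transfer rD covD lCD en)
    ... | C′ , s | D′ , s′ = before
      where
      C′≗D′ : C′ ≗ D′
      C′≗D′ = linked-covered L good (reachable-step rC s) (reachable-step rD s′)
        (covered-fire rC covC s) (covered-fire rD covD s′)
        (linked-step lCD s s′) (linked-step lDC s′ s)

      -- Equality is pulled back through the step: processes of `ℓ` were at `node ℓ` in both, the
      -- others did not move.
      before : C ≗ D
      before p with p ∈? dom (node ℓ)
      ... | yes p∈ = common-node {C} {D} (reachable-atMostOne rC) (reachable-atMostOne rD)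
                       (en p∈) (transfer rD covD lCD en p∈)
      ... | no  p∉ = trans (sym (Step.outside s p∉)) (trans (C′≗D′ p) (Step.outside s′ p∉))

  linked⇒≗ : Reachable 𝒩 C → Reachable 𝒩 D → Linked C D → Linked D C → C ≗ D
  linked⇒≗ rC rD lCD lDC with strategy rC
  ... | L , good , covC with strategy-++ rD good
  ...   | v , good′ , covD =
    linked-covered (v ++ L) good′ rC rD (λ p∈ n∈ → map₁ (++⁺ʳ v) (covC p∈ n∈)) covD lCD lDC

  linked-outside : Run 𝒩 C w D → Within S w →
                   Run 𝒩 C v E → Within S v →
                   dom k ⊈ S → ∃ λ p → p ∈ dom k × D p ≡ E p
  linked-outside ρ w⊆S σ v⊆S k⊈S with ⊈⇒∃∉ k⊈S
  ... | p , p∈k , p∉S = p , p∈k , trans (run-outside ρ w⊆S p∉S) (sym (run-outside σ v⊆S p∉S))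

  -- Stated for any `S`: uniqueness of F(m) takes dom(m), and `heading-step` takes the domain of the
  -- fired location.
  terminal-unique : Reachable 𝒩 C →
    Run 𝒩 C w D → Within S w →
    (∀ k → k ≢ nfin → Enabled 𝒩 k D → dom k ⊈ S) →
    Run 𝒩 C v E → Within S v →
    (∀ k → k ≢ nfin → Enabled 𝒩 k E → dom k ⊈ S) → D ≗ E
  terminal-unique reach ρ w⊆S endD σ v⊆S endE = linked⇒≗
    (reachable-run reach ρ) (reachable-run reach σ)
    (λ k≢ en → linked-outside ρ w⊆S σ v⊆S (endD _ k≢ en))
    (λ k≢ en → linked-outside σ v⊆S ρ w⊆S (endE _ k≢ en))

  -- Strategies leading all of dom(t) to t strictly inside dom(t)

  Heading : Node → Configuration 𝒩 → Set (r ⊔ o)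
  Heading t C = ∃ λ L → StrictlyWithin (dom t) L × Good t L × Covered t L C

  -- Leaving the strategy by another outcome of the fired node is repaired with the
  -- domain of that node, since both outcomes lead to the same terminal configuration for it.
  heading-step : Reachable 𝒩 C → Heading t C → Step 𝒩 C ℓ D → domˡ 𝒩 ℓ ⊂ dom t → Heading t D
  heading-step {C} {t} {ℓ} {D} reach (L , strict , good , cov) s ℓ⊂t@(ℓ⊆t , x , x∈t , x∉ℓ) =
    let open Play in
    let reachD = reachable-step reach s
        z , goodz , covz = strategy reachD
        inside? = λ k → dom k ⊆? domˡ 𝒩 ℓ
        -- `P` follows the old strategy from `C`, `P′` a strategy to `nfin` from `D`, both confined
        -- to the domain of `ℓ`.
        P = play inside? L good C λ {k} en k⊆ℓ →
              let p , p∈k = dom-nonempty k in cov (ℓ⊆t (k⊆ℓ p∈k)) (en p∈k)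
        P′ = play inside? z goodz D λ en _ → covered-enabled covz en
        ends-agree = terminal-unique reach (s ▸ run P′) (id ∷ allowed P′)
          (λ k k≢ en k⊆ℓ → k≢ (terminal P′ en k⊆ℓ)) (run P) (allowed P)
          -- The exception in `terminal P` is `t`, ruled out because its process `x` lies outside
          -- the domain of `ℓ`.
          (λ k k≢ en k⊆ℓ → x∉ℓ (k⊆ℓ (subst (λ n → x ∈ dom n) (sym (terminal P en k⊆ℓ)) x∈t)))
        -- `P` fires only locations of `L`, so `L` still covers the common end, to which the word of
        -- `P′` leads from `D`.
        good′ , cov′ = prolong (reachable-atMostOne reachD) (run-respʳ ends-agree (run P′))
          (strictly⇒within (within-strictly (allowed P′) ℓ⊂t)) good
          (covered-run good (run P) (word⊆L P) cov)
    in word P′ ++ L ,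
       ++⁺ (within-strictly (allowed P′) ℓ⊂t) strict ,
       good′ , cov′

  heading-run : Reachable 𝒩 C → Heading t C →
                Run 𝒩 C w D → StrictlyWithin (dom t) w → Heading t D
  heading-run reach (L , strict , good , cov) (stop C≗D) [] =
    L , strict , good , λ {p} p∈ n∈ → cov p∈ (subst (_ ∈_) (sym (C≗D p)) n∈)
  heading-run reach heading (s ▸ ρ) (ℓ⊂t ∷ w⊂t) =
    heading-run (reachable-step reach s) (heading-step reach heading s ℓ⊂t) ρ w⊂t

  -- If all of dom(t) waits at nodes inside dom(t), none of them enabled, it waits forever.
  not-frozen : Run 𝒩 C w (Cfin 𝒩) → (∀ {p n} → p ∈ dom t → n ∈ C p → dom n ⊆ dom t) →
               ¬ (∀ k → dom k ⊆ dom t → ¬ Enabled 𝒩 k C)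
  not-frozen {C} {t = t} (stop C≗fin) inside frozen =
    frozen nfin (inside (proj₂ (dom-nonempty t)) (at-nfin _)) (λ {p} _ → at-nfin p)
    where
    at-nfin : ∀ p → nfin ∈ C p
    at-nfin p = subst (nfin ∈_) (sym (C≗fin p)) (x∈⁅x⁆ nfin)
  not-frozen {t = t} (_▸_ {C} {D} {ℓ = ℓ} s ρ) inside frozen = not-frozen ρ
    (λ p∈t n∈ → inside p∈t (subst (_ ∈_) (unmoved p∈t) n∈))
    (λ k k⊆t en → frozen k k⊆t (λ {p} p∈k → subst (k ∈_) (unmoved (k⊆t p∈k)) (en p∈k)))
    where
    -- The fired node takes no process of dom(t): it would then be an enabled node inside dom(t),
    -- against `frozen`.
    unmoved : p ∈ dom t → D p ≡ C p
    unmoved p∈t = Step.outside s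
      (λ p∈ℓ → frozen (node ℓ) (inside p∈t (Step.enabled s p∈ℓ)) (Step.enabled s))

  strict-end-enabled : Reachable 𝒩 C →
    Run 𝒩 C w D → StrictlyWithin (dom t) w → Enabled 𝒩 t D →
    Run 𝒩 C v E → StrictlyWithin (dom t) v → (∀ k → Enabled 𝒩 k E → dom k ⊄ dom t) →
    Enabled 𝒩 t E
  strict-end-enabled {C} {w} {D} {t} {E = E} reach ρ w⊂t en σ v⊂t end =
    decidable-stable (Enabled? t E) λ ¬en → not-frozen (proj₂ (completion reachE))
      inside
      (λ k k⊆t en′ → ¬en (subst (λ n → Enabled 𝒩 n E) (blocked k⊆t en′) en′))
    where
    reachD = reachable-run reach ρ
    reachE = reachable-run reach σ

    start : Heading t C
    -- The run to `D` is itself a strategy with target `t`, since at `D` all of dom(t) waits at `t`.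
    start = let good , cov = prolong {t = t} {L = []} (reachable-atMostOne reach) ρ
                               (strictly⇒within w⊂t) tt
                               (λ p∈t n∈ → inj₂ (reachable-atMostOne reachD n∈ (en p∈t)))
            in w ++ [] , ++⁺ w⊂t [] , good , cov

    heading : Heading t E
    heading = heading-run reach start σ v⊂t

    occurs-strict : StrictlyWithin (dom t) L → n occursIn L → dom n ⊂ dom t
    occurs-strict (ℓ⊂t ∷ _) (here refl) = ℓ⊂t
    occurs-strict (_ ∷ L⊂t) (there n∈L) = occurs-strict L⊂t n∈L

    leads-inside : StrictlyWithin (dom t) L → Leads t L n → dom n ⊆ dom t
    leads-inside L⊂t (inj₁ n∈L)  = proj₁ (occurs-strict L⊂t n∈L)
    leads-inside _   (inj₂ refl) = id

    inside : p ∈ dom t → n ∈ E p → dom n ⊆ dom t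
    inside p∈t n∈ with heading
    ... | _ , strict , _ , cov = leads-inside strict (cov p∈t n∈)

    blocked : dom k ⊆ dom t → Enabled 𝒩 k E → k ≡ t
    blocked {k} k⊆t en′ with heading | dom-nonempty k
    ... | L , strict , _ , cov | p , p∈k with cov (k⊆t p∈k) (en′ p∈k)
    ...   | inj₁ k∈L = contradiction (occurs-strict strict k∈L) (end k en′)
    ...   | inj₂ k≡t = k≡t

  -- Existence and uniqueness of I(m), F(m) and F(ℓ)

  I-unique : ∀ m → IsI 𝒩 m C → IsI 𝒩 m D → C ≗ D
  I-unique {C} {D} m (rC , enC , onlyC) (rD , enD , onlyD) =
    linked⇒≗ rC rD (λ _ en → at-m (onlyC _ en) enC enD rC rD)
                   (λ _ en → at-m (onlyD _ en) enD enC rD rC)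
    where
    at-m : k ≡ m → Enabled 𝒩 m E → Enabled 𝒩 m E′ → Reachable 𝒩 E → Reachable 𝒩 E′ →
           ∃ λ p → p ∈ dom k × E p ≡ E′ p
    at-m {E = E} {E′} refl en en′ rE rE′ = let p , p∈ = dom-nonempty m in
      p , p∈ , common-node {E} {E′} (reachable-atMostOne rE) (reachable-atMostOne rE′)
                                    (en p∈) (en′ p∈)

  -- Every node but `m` is allowed in the play, so the processes of `m` wait at `m` throughout.
  I-exists : ∀ m → ReachableNode 𝒩 m → ∃ (IsI 𝒩 m)
  I-exists m (C , reach , en) with strategy reach
  ... | L , good , cov with play (λ k → ¬? (k ≟ m)) L good C (λ en _ → covered-enabled cov en)
  ...   | mkPlay {end = E} ρ avoids _ terminal = E , reachE , m-enabled , only-m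
    where
    reachE = reachable-run reach ρ

    m-enabled : Enabled 𝒩 m E
    m-enabled p∈ = stay (reachable-atMostOne reach) ρ avoids (en p∈)

    only-m : ∀ n → Enabled 𝒩 n E → n ≡ m
    -- Otherwise `n` is `nfin`, and a process of `m` would be at two nodes.
    only-m n enn = decidable-stable (n ≟ m) λ n≢m → let p , p∈ = dom-nonempty m in
      n≢m (reachable-atMostOne reachE
             (enn (subst (λ x → p ∈ dom x) (sym (terminal enn n≢m)) p∈dom-nfin)) (m-enabled p∈))

  F-exists : ∀ m → Reachable 𝒩 C → ∃ (IsF 𝒩 m C)
  F-exists {C} m reach with strategy reach
  ... | L , good , cov with play (λ k → dom k ⊆? dom m) L good C (λ en _ → covered-enabled cov en)
  ...   | mkPlay {w} {E} ρ inside _ terminal =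
    E , (w , inside , ρ) , λ n n≢nfin en n⊆m → n≢nfin (terminal en n⊆m)

  F-unique : ∀ m → Reachable 𝒩 C → IsF 𝒩 m C D → IsF 𝒩 m C E → D ≗ E
  F-unique m reach ((_ , w⊆m , ρ) , endD) ((_ , v⊆m , σ) , endE) =
    terminal-unique reach ρ w⊆m endD σ v⊆m endE

  Fˡ-exists : ∀ ℓ → Reachable 𝒩 C → Enabled 𝒩 (node ℓ) C → ∃ (IsFˡ 𝒩 ℓ C)
  Fˡ-exists {C} ℓ reach en with fire ℓ en
  ... | D , s with strategy (reachable-step reach s)
  ...   | L , good , cov
    with play (λ k → dom k ⊂? domˡ 𝒩 ℓ) L good D (λ en _ → covered-enabled cov en)
  ...     | mkPlay {w} {E} ρ inside _ terminal =
    E , (w , (id ∷ strictly⇒within inside , inside) , s ▸ ρ) ,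
    λ n enn n⊂ℓ → nfin-not-smaller (terminal enn n⊂ℓ) n⊂ℓ
    where
    -- The play may end with `nfin` enabled, but its domain is all of `Proc` and so strictly inside
    -- no domain.
    nfin-not-smaller : n ≡ nfin → dom n ⊄ domˡ 𝒩 ℓ
    nfin-not-smaller refl (_ , _ , _ , x∉) = x∉ p∈dom-nfin

  -- A node not inside dom(n) has a process that neither run moves; one inside has domain dom(n) by
  -- `endD`, and is then enabled at both ends by `strict-end-enabled`.
  strict-linked : Reachable 𝒩 C →
    Run 𝒩 C w D → StrictlyWithin (dom n) w → (∀ k → Enabled 𝒩 k D → dom k ⊄ dom n) →
    Run 𝒩 C v E → StrictlyWithin (dom n) v → (∀ k → Enabled 𝒩 k E → dom k ⊄ dom n) → Linked D E
  strict-linked {C} {w} {D} {n} {v} {E} reach ρ w⊂n endD σ v⊂n endE {k} _ en with dom k ⊆? dom n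
  ... | no k⊈n = linked-outside ρ (strictly⇒within w⊂n)
                                σ (strictly⇒within v⊂n) k⊈n
  ... | yes k⊆n with dom-nonempty k
  ...   | p , p∈k = p , p∈k , common-node {D} {E} (reachable-atMostOne (reachable-run reach ρ))
                                                  (reachable-atMostOne (reachable-run reach σ))
                                                  (en p∈k) (enE p∈k)
    where
    n≡k : dom n ≡ dom k
    n≡k = ⊆-antisym (λ {x} x∈n → decidable-stable (x ∈? dom k)
                      λ x∉k → endD k en (k⊆n , x , x∈n , x∉k)) k⊆n

    narrow : StrictlyWithin (dom n) L → StrictlyWithin (dom k) L
    narrow {L} = subst (λ S → StrictlyWithin S L) n≡k

    enE : Enabled 𝒩 k E
    enE = strict-end-enabled reach ρ (narrow w⊂n) en σ (narrow v⊂n)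
            (subst (λ S → ∀ j → Enabled 𝒩 j E → dom j ⊄ S) n≡k endE)

  Fˡ-unique : ∀ ℓ → Reachable 𝒩 C → IsFˡ 𝒩 ℓ C D → IsFˡ 𝒩 ℓ C E → D ≗ E
  Fˡ-unique ℓ reach ((_ , (_ , w⊂ℓ) , s ▸ ρ) , endD) ((_ , (_ , v⊂ℓ) , s′ ▸ σ) , endE) =
    linked⇒≗ (reachable-run reach′ ρ) (reachable-run reach′ σ′)
      (strict-linked {n = node ℓ} reach′ ρ w⊂ℓ endD σ′ v⊂ℓ endE)
      (strict-linked {n = node ℓ} reach′ σ′ v⊂ℓ endE ρ w⊂ℓ endD)
    where
    reach′ = reachable-step reach s
    -- Both runs begin with `ℓ`, hence pass through one configuration, from which the strict
    -- remainders are compared.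
    σ′     = run-respˡ (step-functional s′ s) σ

theorem2 : {r o : Level} (𝒩 : Negotiation r o) → Deterministic 𝒩 → Sound 𝒩 →
    (m : Negotiation.Node 𝒩) → ReachableNode 𝒩 m →
    ∃! _≗_ (IsI 𝒩 m) ×
    (∀ I → IsI 𝒩 m I →
    ∃! _≗_ (IsF 𝒩 m I) ×
    (∀ a (a∈out : Negotiation.out 𝒩 m a) → ∃! _≗_ (IsFˡ 𝒩 (loc m a a∈out) I)))
theorem2 𝒩 det sound m reachable =
  unique (I-exists m reachable) (I-unique m) ,
  λ { I (reach , enabled , _) →
    unique (F-exists m reach) (F-unique m reach) ,
    λ a a∈out → unique (Fˡ-exists (loc m a a∈out) reach enabled)
                        (Fˡ-unique (loc m a a∈out) reach) }
  where
  open SoundDeterministic 𝒩 det sound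

  unique : ∀ {p} {P : Configuration 𝒩 → Set p} →
           ∃ P → (∀ {C D} → P C → P D → C ≗ D) → ∃! _≗_ P
  unique (C , PC) same = C , PC , same PC
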